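{- Let $\Sigma$ be a finite alphabet. If a language $L\subseteq\Sigma^\omega$ is $\omega$-regular and positional over state-labelled arenas, then $L$ is $\omega$-star-free.
   Context: **Games.** A state-labelled arena is a tuple $(V_1,V_2,\delta,\pi)$ where $V_1,V_2$ are disjoint finite sets of states controlled by Player 1 and Player 2, $V=V_1\sqcup V_2$, $\delta\subseteq V\times V$ is total (every state has at least one outgoing edge) and $\pi:V\to\Sigma$ labels states. For $e=(v,v')\in\delta$ write $src(e)=v$, $tgt(e)=v'$. A strategy is a function $\sigma:V\cup\delta^+\to\delta$ with $src(\sigma(v))=v$ for $v\in V$ and $src(\sigma(we))=tgt(e)$ for $w\in\delta^*$, $e\in\delta$. A positional strategy is a function $\sigma:V\to\delta$ with $src(\sigma(v))=v$ (the move depends only on the current state). Strategies $\sigma_1,\sigma_2$ and an initial state $q$ determine a play $\varsigma\in\delta^\omega$: at each step, if the current state lies in $V_i$, the next edge is the one given by $\sigma_i$ applied to the history of edges so far (to $q$ at the first step; to the current state if $\sigma_i$ is positional). Its trace is the word $\pi(src(\varsigma[0]))\pi(src(\varsigma[1]))\cdots\in\Sigma^\omega$. For an objective $L\subseteq\Sigma^\omega$, a strategy $\sigma_1$ is winning for Player 1 from $q$ if for every strategy $\sigma_2$ the trace of the play from $q$ lies in $L$. **Positionality.** $L$ is positional over state-labelled arenas if for every state-labelled arena, every $W\subseteq V$, and every strategy that is winning for Player 1 (objective $L$) from all states of $W$, there is a single positional strategy that is winning for Player 1 from all states of $W$. **$\omega$-star-free.** $L\subseteq\Sigma^\omega$ is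 $\omega$-star-free if it is recognised by a finite aperiodic monoid: there are a finite monoid $M$ such that for each $x\in M$ there is $n$ with $x^n=x^{n+1}$, and a monoid homomorphism $h:\Sigma^*\to M$, such that whenever $w=w_0w_1\cdots$ and $w'=w_0'w_1'\cdots$ with $w_i,w_i'\in\Sigma^+$ and $h(w_i)=h(w_i')$ for all $i$, then $w\in L\iff w'\in L$. Equivalently, $L$ is definable by a formula of linear-time temporal logic over $\Sigma$. -}

module Defs where

open import Algebra.Bundles using (Monoid)
import Algebra.Definitions.RawMonoid as RawMonoidDefinitions
open import Algebra.Morphism.Structures using (IsMonoidHomomorphism)
open import Data.Bool.Base using (Bool; T)
open import Data.Fin.Base using (Fin)
open import Data.List.Base as List using (List; []; _∷_)
open import Data.List.NonEmpty.Base
  using (List⁺; head; tail; toList; [_]; _∷ʳ_; _⁺∷ʳ_; last; snocView; _∷ʳ′_)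
open import Data.List.Properties using (++-monoid; ∷ʳ-injectiveʳ)
open import Data.Nat.Base using (ℕ; zero; suc; _≤_)
open import Data.Product.Base using (Σ; ∃; _×_; _,_)
open import Data.Sum.Base using (_⊎_; inj₁; inj₂)
open import Function.Base using (_∘_)
open import Function.Bundles using (_↔_; _⇔_; Inverse)
open import Level using (0ℓ)
open import Relation.Binary.Bundles using (Setoid)
open import Relation.Binary.PropositionalEquality
  using (_≡_; _≗_; refl; sym; trans; cong; setoid)
open import Relation.Unary using (Pred; _∈_)

FiniteSetoid : Setoid 0ℓ 0ℓ → Set
FiniteSetoid S = ∃ λ n → Inverse S (setoid (Fin n))

Finite : Set → Set
Finite X = ∃ λ n → X ↔ Fin n

Word^ω : Set → Set
Word^ω A = ℕ → A

Language^ω : Set → Set₁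
Language^ω A = Pred (Word^ω A) 0ℓ

-- after u ws  is the infinite word  u · ws 0 · ws 1 · ws 2 ⋯

after : {A : Set} → List A → (ℕ → List⁺ A) → Word^ω A
after (x ∷ u) ws zero    = x
after (x ∷ u) ws (suc n) = after u ws n
after []      ws zero    = head (ws 0)
after []      ws (suc n) = after (tail (ws 0)) (ws ∘ suc) n

concat^ω : {A : Set} → (ℕ → List⁺ A) → Word^ω A
concat^ω = after []

record BüchiAutomaton (A : Set) : Set₁ where
  field
    State     : Set
    finite    : Finite State
    Initial   : Pred State 0ℓ
    Step      : State → A → State → Set
    Accepting : Pred State 0ℓ

  record AcceptingRun (w : Word^ω A) : Set where
    field
      run             : ℕ → State
      starts          : run 0 ∈ Initial
      steps           : ∀ n → Step (run n) (w n) (run (suc n))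
      infinitelyOften : ∀ n → ∃ λ m → n ≤ m × run m ∈ Accepting

ωRegular : {A : Set} → Language^ω A → Set₁
ωRegular {A} L =
  Σ (BüchiAutomaton A) λ B →
    ∀ w → w ∈ L ⇔ BüchiAutomaton.AcceptingRun B w

Aperiodic : Monoid 0ℓ 0ℓ → Set
Aperiodic M = ∀ x → ∃ λ n → (x ^ n) ≈ (x ^ suc n)
  where
  open Monoid M using (_≈_; rawMonoid)
  _^_ : Monoid.Carrier M → ℕ → Monoid.Carrier M
  x ^ n = RawMonoidDefinitions._×_ rawMonoid n x

Recognises : {A : Set} (M : Monoid 0ℓ 0ℓ) →
             (List A → Monoid.Carrier M) → Language^ω A → Set
Recognises M h L =
  ∀ w w′ ws ws′ → w ≗ concat^ω ws → w′ ≗ concat^ω ws′ →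
  (∀ i → h (toList (ws i)) ≈ h (toList (ws′ i))) →
  w ∈ L ⇔ w′ ∈ L
  where open Monoid M using (_≈_)

record ωStarFree {A : Set} (L : Language^ω A) : Set₁ where
  field
    monoid         : Monoid 0ℓ 0ℓ
    finite         : FiniteSetoid (Monoid.setoid monoid)
    aperiodic      : Aperiodic monoid
    h              : List A → Monoid.Carrier monoid
    isHomomorphism : IsMonoidHomomorphism (Monoid.rawMonoid (++-monoid A))
                                          (Monoid.rawMonoid monoid) h
    recognises     : Recognises monoid h L

-- δ is Boolean-valued so that an edge is determined by its endpoints.

record Arena (A : Set) : Set₁ where
  field
    V₁ V₂   : Set
    finite₁ : Finite V₁
    finite₂ : Finite V₂

  V : Set
  V = V₁ ⊎ V₂

  field
    δ     : V → V → Bool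
    total : ∀ v → ∃ λ v′ → T (δ v v′)
    π     : V → A

last-∷ʳ : {X : Set} (xs : List X) (x : X) → last (xs ∷ʳ x) ≡ x
last-∷ʳ {X} xs x = go (xs ∷ʳ x) refl
  where
  toList-∷ʳ : (ys : List X) (y : X) → toList (ys ∷ʳ y) ≡ ys List.∷ʳ y
  toList-∷ʳ []       y = refl
  toList-∷ʳ (_ ∷ ys) y = refl

  go : ∀ l → l ≡ xs ∷ʳ x → last l ≡ x
  go l eq with snocView l
  ... | ys ∷ʳ′ y = ∷ʳ-injectiveʳ ys xs
    (trans (sym (toList-∷ʳ ys y)) (trans (cong toList eq) (toList-∷ʳ xs x)))

module Game {A : Set} (G : Arena A) where
  open Arena G

  record Edge : Set where
    constructor edge
    field
      src tgt : V
      isEdge  : T (δ src tgt)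
  open Edge public

  -- V ∪ δ⁺. As in the definition of a strategy, consecutive edges need
  -- not be adjacent.

  History : Set
  History = V ⊎ List⁺ Edge

  current : History → V
  current (inj₁ v) = v
  current (inj₂ w) = tgt (last w)

  extend : History → Edge → History
  extend (inj₁ _) e = inj₂ [ e ]
  extend (inj₂ w) e = inj₂ (w ⁺∷ʳ e)

  record Strategy : Set where
    field
      move      : History → Edge
      src-start : ∀ v → src (move (inj₁ v)) ≡ v
      src-next  : ∀ w e → src (move (inj₂ (w ∷ʳ e))) ≡ tgt e
  open Strategy public

  record PositionalStrategy : Set where
    field
      choose     : V → Edge
      src-choose : ∀ v → src (choose v) ≡ v
  open PositionalStrategy public

  toStrategy : PositionalStrategy → Strategy
  toStrategy τ .move h         = choose τ (current h)
  toStrategy τ .src-start v    = src-choose τ v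
  toStrategy τ .src-next w e   =
    trans (src-choose τ _) (cong tgt (last-∷ʳ w e))

  module _ (σ₁ σ₂ : Strategy) where

    moveAt : V → History → Edge
    moveAt (inj₁ _) = move σ₁
    moveAt (inj₂ _) = move σ₂

    nextEdge : History → Edge
    nextEdge h = moveAt (current h) h

    historyAt : V → ℕ → History
    historyAt q zero    = inj₁ q
    historyAt q (suc n) = extend (historyAt q n) (nextEdge (historyAt q n))

    play : V → ℕ → Edge
    play q n = nextEdge (historyAt q n)

    trace : V → Word^ω A
    trace q n = π (src (play q n))

  WinningFrom : Language^ω A → Strategy → V → Set
  WinningFrom L σ₁ q = ∀ σ₂ → trace σ₁ σ₂ q ∈ L

Positional : {A : Set} → Language^ω A → Set₁
Positional {A} L =
  (G : Arena A) → let open Arena G; open Game G in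
  (W : Pred V 0ℓ) (σ : Strategy) →
  (∀ q → q ∈ W → WinningFrom L σ q) →
  ∃ λ (τ : PositionalStrategy) → ∀ q → q ∈ W → WinningFrom L (toStrategy τ) q

{-# OPTIONS --safe #-}
module Submission where

-- Let u ≈ v mean that u and v are interchangeable in the stem and in the
-- period of every lasso x · z^ω. A Ramsey factorisation shows that the finite
-- quotient of the free monoid by ≈ recognises L. By finiteness u^n ≈ u^(n+p)
-- for some n and p ≥ 1, and positionality forces all u^g and u^b with
-- g, b ≥ n to be interchangeable: in the lasso, replace the power of u by a
-- gadget where Player 2 reads u^r with r of his choice and Player 1 then
-- completes it with u^s. If the lasso with u^g is in L, Player 1 wins by
-- choosing s so that the exponent is g modulo p. A positional strategy uses
-- the same s against every r, so Player 2 can steer the exponent to b modulo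
-- p, and hence the lasso with u^b is in L too.

open import Defs
open import Algebra.Bundles using (Monoid)
import Algebra.Definitions.RawMonoid as RawMonoidDefinitions
open import Axiom.ExcludedMiddle using (ExcludedMiddle)
open import Data.Bool.Base using (Bool; true; false; T; _∧_; _∨_)
open import Data.Fin.Base using (Fin; zero; suc; toℕ; fromℕ; fromℕ<; inject₁; combine; funToFin; finToFun)
open import Data.Fin.Properties
  using (toℕ-injective; toℕ-fromℕ; toℕ-fromℕ<; toℕ-inject₁; toℕ<n; combine-injective;
         finToFun-funToFin; pigeonhole; 1↔⊤; 2↔Bool)
open import Data.List.Base
  using (List; []; _∷_; _++_; length; null; map; concatMap; allFin; lookup; deduplicate)
open import Data.List.Membership.Propositional using () renaming (_∈_ to _∈ₗ_)
open import Data.List.Membership.Propositional.Properties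
  using (∈-allFin; ∈-lookup; ∈-map⁺; ∈-++⁺ˡ; ∈-++⁺ʳ; ∈-concatMap⁺)
open import Data.List.NonEmpty.Base
  using (List⁺; _∷_; tail; toList; last; snocView; SnocView; _∷ʳ′_; _∷ʳ_; _⁺++⁺_; _++⁺_)
open import Data.List.Properties using (length-++; ++-assoc; ++-identityʳ)
import Data.List.Relation.Unary.All as All
open import Data.List.Relation.Unary.AllPairs using (AllPairs; []; _∷_)
open import Data.List.Relation.Unary.Any as Any using (Any; here; there)
open import Data.List.Relation.Unary.Any.Properties using (concatMap⁺; deduplicate⁺; lookup-index)
open import Data.List.Relation.Unary.Unique.DecSetoid.Properties using (deduplicate-!)
open import Data.Nat.Base using (ℕ; zero; suc; _+_; _*_; _^_; _∸_; _⊔_; _≤_; _<_; z≤n; s≤s)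
open import Data.Nat.Properties
open import Data.Nat.Tactic.RingSolver using (solve-∀)
open import Data.Product.Base using (Σ; ∃; ∃₂; _×_; _,_; proj₁; proj₂)
open import Data.Sum.Base as Sum using (_⊎_; inj₁; inj₂; [_,_]′)
open import Data.Unit.Base using (⊤; tt)
open import Function.Base using (_∘_; const; id)
open import Function.Bundles using (_⇔_; mk⇔; Equivalence; Inverse)
open import Function.Properties.Inverse using (↔-sym)
open import Level using (0ℓ)
open import Relation.Binary.Bundles using (Setoid; DecSetoid)
open import Relation.Binary.PropositionalEquality
  using (_≡_; _≢_; _≗_; refl; sym; trans; cong; cong₂; subst; subst₂; setoid; module ≡-Reasoning)
open import Relation.Nullary using (¬_; yes; no; contradiction)
open import Relation.Nullary.Decidable using (decidable-stable; isYes; fromWitness; toWitness)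
open import Relation.Unary using (Pred)

private variable
  A : Set

-- Factorisations of infinite words into nonempty finite words.

Reads : Word^ω A → ℕ → List A → Set
Reads w t []      = ⊤
Reads w t (a ∷ u) = w t ≡ a × Reads w (suc t) u

reads-++ : ∀ {w : Word^ω A} {t} u {v} →
           Reads w t u → Reads w (length u + t) v → Reads w t (u ++ v)
reads-++ []      _          rv = rv
reads-++ {w = w} {t} (a ∷ u) {v} (eq , ru) rv =
  eq , reads-++ u ru (subst (λ s → Reads w s v) (sym (+-suc (length u) t)) rv)

-- The recursion passes to the shifted sequence, so that a factorisation `f` from `t` yields
-- `f ∘ suc` as one of the remaining word by computation; `pos-suc` supplies the recursion at the
-- other end.
pos : (ℕ → List⁺ A) → ℕ → ℕ → ℕ
pos ws t zero    = t
pos ws t (suc k) = pos (ws ∘ suc) (length (toList (ws 0)) + t) k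

pos-suc : ∀ (ws : ℕ → List⁺ A) t k →
          pos ws t (suc k) ≡ length (toList (ws k)) + pos ws t k
pos-suc ws t zero    = refl
pos-suc ws t (suc k) = pos-suc (ws ∘ suc) _ k

pos-increasing : ∀ (ws : ℕ → List⁺ A) k → k ≤ pos ws 0 k
pos-increasing ws zero    = z≤n
pos-increasing ws (suc k) = subst (suc k ≤_) (sym (pos-suc ws 0 k))
  (s≤s (≤-trans (pos-increasing ws k) (m≤n+m _ _)))

Factorises : Word^ω A → (ℕ → List⁺ A) → ℕ → Set
Factorises w ws t = ∀ k → Reads w (pos ws t k) (toList (ws k))

-- The pending prefix `u` generalises the claim along the recursion of `after`, which goes on with
-- the tail of a factor once its head is consumed.
factorises⇒after : ∀ {w : Word^ω A} {ws t t′} u → Factorises w ws t → Reads w t′ u →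
                   t ≡ length u + t′ → ∀ n → w (n + t′) ≡ after u ws n
factorises⇒after (a ∷ u) f (eq , r) t≡ zero = eq
factorises⇒after {w = w} {t′ = t′} (a ∷ u) f (eq , r) t≡ (suc n) =
  trans (cong w (sym (+-suc n t′)))
        (factorises⇒after u f r (trans t≡ (sym (+-suc (length u) t′))) n)
factorises⇒after [] f r refl zero = proj₁ (f 0)
factorises⇒after {w = w} {ws} {t} [] f r refl (suc n) =
  trans (cong w (sym (+-suc n t)))
        (factorises⇒after (tail (ws 0)) (f ∘ suc) (proj₂ (f 0))
                          (sym (+-suc (length (tail (ws 0))) t)) n)

factorises⇒≗ : ∀ {w : Word^ω A} {ws} → Factorises w ws 0 → w ≗ concat^ω ws
factorises⇒≗ {w = w} f n =
  trans (cong w (sym (+-identityʳ n))) (factorises⇒after [] f tt refl n)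

after⇒reads : ∀ {w : Word^ω A} {ws t} u → (∀ n → w (n + t) ≡ after u ws n) →
              Reads w t u × (∀ n → w (n + (length u + t)) ≡ concat^ω ws n)
after⇒reads []      f = tt , f
after⇒reads {w = w} {ws} {t} (a ∷ u) f =
  let r , g = after⇒reads u (λ n → trans (cong w (+-suc n t)) (f (suc n)))
  in (f 0 , r) , λ n → trans (cong (λ s → w (n + s)) (sym (+-suc (length u) t))) (g n)

concat⇒after : ∀ (ws : ℕ → List⁺ A) n → concat^ω ws n ≡ after (toList (ws 0)) (ws ∘ suc) n
concat⇒after ws zero    = refl
concat⇒after ws (suc n) = refl

≗⇒factorises′ : ∀ {w : Word^ω A} {ws t} → (∀ n → w (n + t) ≡ concat^ω ws n) →
                Factorises w ws t
≗⇒factorises′ {ws = ws} f zero =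
  proj₁ (after⇒reads (toList (ws 0)) (λ n → trans (f n) (concat⇒after ws n)))
≗⇒factorises′ {w = w} {ws = ws} f (suc k) =
  ≗⇒factorises′ {w = w}
    (proj₂ (after⇒reads {w = w} (toList (ws 0)) (λ n → trans (f n) (concat⇒after ws n)))) k

≗⇒factorises : ∀ {w : Word^ω A} {ws} → w ≗ concat^ω ws → Factorises w ws 0
≗⇒factorises {w = w} f = ≗⇒factorises′ (λ n → trans (cong w (+-identityʳ n)) (f n))

-- The parameter `d` is one less than the number of factors joined, which makes the product nonempty
-- by construction.
seg : (ℕ → List⁺ A) → ℕ → ℕ → List⁺ A
seg ws j zero    = ws j
seg ws j (suc d) = seg ws j d ⁺++⁺ ws (suc (d + j))

length-seg : ∀ (ws : ℕ → List⁺ A) j d →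
             length (toList (seg ws j d)) + pos ws 0 j ≡ pos ws 0 (suc (d + j))
length-seg ws j zero    = sym (pos-suc ws 0 j)
length-seg ws j (suc d) = begin
  length (u ++ v) + p                 ≡⟨ cong (_+ p) (length-++ u) ⟩
  length u + length v + p             ≡⟨ cong (_+ p) (+-comm (length u) (length v)) ⟩
  length v + length u + p             ≡⟨ +-assoc (length v) (length u) p ⟩
  length v + (length u + p)           ≡⟨ cong (length v +_) (length-seg ws j d) ⟩
  length v + pos ws 0 (suc (d + j))   ≡⟨ sym (pos-suc ws 0 (suc (d + j))) ⟩
  pos ws 0 (suc (suc (d + j)))        ∎
  where
  open ≡-Reasoning
  u = toList (seg ws j d)
  v = toList (ws (suc (d + j)))
  p = pos ws 0 j

reads-seg : ∀ {w : Word^ω A} {ws} → Factorises w ws 0 →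
            ∀ j d → Reads w (pos ws 0 j) (toList (seg ws j d))
reads-seg f j zero    = f j
reads-seg {w = w} {ws} f j (suc d) = reads-++ (toList (seg ws j d)) (reads-seg f j d)
  (subst (λ s → Reads w s (toList (ws (suc (d + j))))) (sym (length-seg ws j d)) (f (suc (d + j))))

-- The block starting at factor `i k` ends right before factor `i (suc k)`, so block boundaries are
-- boundaries of the old factorisation.
regroup : ∀ {w : Word^ω A} {ws} → Factorises w ws 0 →
          (i d : ℕ → ℕ) → i 0 ≡ 0 → (∀ k → i (suc k) ≡ suc (d k + i k)) →
          Factorises w (λ k → seg ws (i k) (d k)) 0
regroup {w = w} {ws} f i d i₀ i-suc k =
  subst (λ s → Reads w s (toList (seg ws (i k) (d k)))) (sym (pos-i k)) (reads-seg f (i k) (d k))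
  where
  pos-i : ∀ k → pos (λ k → seg ws (i k) (d k)) 0 k ≡ pos ws 0 (i k)
  pos-i zero    = sym (cong (pos ws 0) i₀)
  pos-i (suc k) = trans (pos-suc _ 0 k)
    (trans (cong (length (toList (seg ws (i k) (d k))) +_) (pos-i k))
    (trans (length-seg ws (i k) (d k)) (cong (pos ws 0) (sym (i-suc k)))))

infixr 5 _∷ω_
_∷ω_ : {X : Set} → X → (ℕ → X) → ℕ → X
(x ∷ω xs) zero    = x
(x ∷ω xs) (suc n) = xs n

lasso : List⁺ A → List⁺ A → Word^ω A
lasso X Z = concat^ω (X ∷ω const Z)

-- `X` is an invariant of positions from which a next factor can always be read; unfolding it gives
-- a factorisation of the rest of the word.
module _ {w : Word^ω A} (X : ℕ → Set) (P : List⁺ A → Set)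
         (next : ∀ {t} → X t → ∃ λ u → P u × Reads w t (toList u) × X (length (toList u) + t)) where

  factors : ∀ {t} → X t → ℕ → List⁺ A
  factors x zero    = proj₁ (next x)
  factors x (suc k) = factors (proj₂ (proj₂ (proj₂ (next x)))) k

  factors-P : ∀ {t} (x : X t) k → P (factors x k)
  factors-P x zero    = proj₁ (proj₂ (next x))
  factors-P x (suc k) = factors-P (proj₂ (proj₂ (proj₂ (next x)))) k

  factors-factorise : ∀ {t} (x : X t) → Factorises w (factors x) t
  factors-factorise x zero    = proj₁ (proj₂ (proj₂ (next x)))
  factors-factorise x (suc k) = factors-factorise (proj₂ (proj₂ (proj₂ (next x)))) k

-- The infinite pigeonhole principle and Ramsey's theorem.

Infinite : (ℕ → Set) → Set
Infinite S = ∀ m → ∃ λ j → m ≤ j × S j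

upper-bound : ∀ {K} (f : Fin K → ℕ) → ∃ λ m → ∀ e → f e ≤ m
upper-bound {zero}  f = 0 , λ ()
upper-bound {suc K} f with upper-bound (f ∘ suc)
... | m , f≤m = f zero ⊔ m , λ where
  zero    → m≤m⊔n _ _
  (suc e) → ≤-trans (f≤m e) (m≤n⊔m (f zero) m)

module Classical (em : ExcludedMiddle 0ℓ) where

  by-contradiction : {P : Set} → ¬ ¬ P → P
  by-contradiction = decidable-stable em

  abstract
    -- Otherwise each colour would stop occurring in `S` at some bound, and a member of `S` beyond
    -- the largest bound would have no colour left.
    pigeonhole^ω : ∀ {K} {S : ℕ → Set} → Infinite S → (f : ℕ → Fin K) →
                   ∃ λ e → Infinite (λ j → S j × f j ≡ e)
    pigeonhole^ω {S = S} inf f = by-contradiction λ none →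
      let bounded : ∀ e → ∃ λ m → ∀ j → m ≤ j → S j → f j ≢ e
          bounded e = by-contradiction λ ¬b → none (e , λ m → by-contradiction λ ¬∃ →
            ¬b (m , λ j m≤j s eq → ¬∃ (j , m≤j , s , eq)))
          M , ≤M = upper-bound (proj₁ ∘ bounded)
          j , M≤j , s = inf M
      in proj₂ (bounded (f j)) j (≤-trans (≤M (f j)) M≤j) s refl

  module _ {K} (c : ℕ → ℕ → Fin K) where

    private
      record Stage : Set₁ where
        field
          Member   : ℕ → Set
          infinite : Infinite Member

        least : ℕ
        least = proj₁ (infinite 0)

        least-member : Member least
        least-member = proj₂ (proj₂ (infinite 0))

        later : Infinite (λ j → Member j × least < j)
        later m with infinite (m ⊔ suc least)
        ... | j , ≤j , sj = j , ≤-trans (m≤m⊔n _ _) ≤j , sj , ≤-trans (m≤n⊔m m _) ≤j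

        coloured : ∃ λ e → Infinite (λ j → (Member j × least < j) × c least j ≡ e)
        coloured = pigeonhole^ω later (c least)

        colour : Fin K
        colour = proj₁ coloured

      open Stage

      -- Keeps the members above `least` that form with it pairs of a colour occurring infinitely
      -- often. Here `least` is the member found by a search from 0; minimality is not claimed.
      refine : Stage → Stage
      refine s .Member j = (Member s j × least s < j) × c (least s) j ≡ colour s
      refine s .infinite = proj₂ (coloured s)

      stage : ℕ → Stage
      stage zero    = record { Member = λ _ → ⊤ ; infinite = λ m → m , ≤-refl , tt }
      stage (suc n) = refine (stage n)

      a : ℕ → ℕ
      a n = least (stage n)

      shrink : ∀ k n {j} → Member (stage (k + n)) j → Member (stage n) j
      shrink zero    n s = s
      shrink (suc k) n s = shrink k n (proj₁ (proj₁ s))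

      -- Stages shrink, so `a n` still belongs to stage `suc m`, and membership there fixes both the
      -- order and the colour relative to `a m`.
      homogeneous : ∀ {m n} → m < n → a m < a n × c (a m) (a n) ≡ colour (stage m)
      homogeneous {m} {n} m<n =
        let (_ , lt) , eq = shrink (n ∸ suc m) (suc m) {a n}
              (subst (λ k → Member (stage k) (a n)) (sym (m∸n+n≡m m<n)) (least-member (stage n)))
        in lt , eq

    -- The colour of a pair now depends on the smaller stage alone, so a second pigeonhole leaves
    -- infinitely many stages of one colour. Consecutive pairs are recorded because they delimit the
    -- blocks of a word.
    ramsey : ∃ λ e → ∃ λ (i : ℕ → ℕ) → ∀ k → i k < i (suc k) × c (i k) (i (suc k)) ≡ e
    ramsey with pigeonhole^ω {S = λ _ → ⊤} (λ m → m , ≤-refl , tt) (λ n → colour (stage n))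
    ... | e , inf = e , (λ k → a (n k)) , step
      where
      n : ℕ → ℕ
      n zero    = proj₁ (inf 0)
      n (suc k) = proj₁ (inf (suc (n k)))

      n-colour : ∀ k → colour (stage (n k)) ≡ e
      n-colour zero    = proj₂ (proj₂ (proj₂ (inf 0)))
      n-colour (suc k) = proj₂ (proj₂ (proj₂ (inf (suc (n k)))))

      step : ∀ k → a (n k) < a (n (suc k)) × c (a (n k)) (a (n (suc k))) ≡ e
      step k with homogeneous (proj₁ (proj₂ (inf (suc (n k)))))
      ... | lt , eq = lt , trans eq (n-colour k)

  -- Restated in the format of `seg`, where a gap is one less than the distance between two cuts.
  ramsey-gaps : ∀ {K} (c : ℕ → ℕ → Fin K) → ∃ λ e → ∃ λ (i : ℕ → ℕ) → ∃ λ (d : ℕ → ℕ) →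
                ∀ k → i (suc k) ≡ suc (d k + i k) × c (i k) (d k) ≡ e
  ramsey-gaps c with ramsey (λ i j → c i (j ∸ suc i))
  ... | e , i , h = e , i , (λ k → i (suc k) ∸ suc (i k)) , λ k →
    trans (sym (m∸n+n≡m (proj₁ (h k)))) (+-suc _ (i k)) , proj₂ (h k)

-- Büchi automata: transition profiles and saturation.

module BüchiPaths (em : ExcludedMiddle 0ℓ) {A : Set} (B : BüchiAutomaton A) where
  open Classical em
  open BüchiAutomaton B

  -- T b is only evidence that an accepting state is visited before the
  -- last state; b = false claims nothing.
  Path : State → Bool → List A → State → Set
  Path p b []      q = ¬ T b × p ≡ q
  Path p b (a ∷ u) q = ∃₂ λ r c → Step p a r × Path r c u q × (T b → Accepting p ⊎ T c)

  -- A path may forget a visit to an accepting state, so any flag `d` that implies one of the two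
  -- given flags is allowed.
  path-++ : ∀ {p b r c q d} u {v} → Path p b u r → Path r c v q →
            (T d → T b ⊎ T c) → Path p d (u ++ v) q
  path-++ {p} {b} {r} {c} {q} {d} [] {v} (¬b , refl) π h = weaken v π
    where
    weaken : ∀ v → Path r c v q → Path r d v q
    weaken []      (¬c , eq) = [ ¬b , ¬c ]′ ∘ h , eq
    weaken (a ∷ v) (s , e , st , π , k) = s , e , st , π , λ td →
      [ (λ tb → contradiction tb ¬b) , k ]′ (h td)
  path-++ {b = b} {c = c} (a ∷ u) (s , e , st , ρ , k) π h =
    s , e ∨ c , st , path-++ u ρ π (split e) , λ td →
      [ Sum.map₂ (injectˡ e) ∘ k , inj₂ ∘ injectʳ e ]′ (h td)
    where
    split : ∀ e → T (e ∨ c) → T e ⊎ T c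
    split true  t = inj₁ t
    split false t = inj₂ t
    injectˡ : ∀ e → T e → T (e ∨ c)
    injectˡ true t = t
    injectʳ : ∀ e → T c → T (e ∨ c)
    injectʳ true  t = tt
    injectʳ false t = t

  -- `Accepting` is an arbitrary predicate, so whether the visit falls into the left part is decided
  -- by excluded middle.
  path-split : ∀ {p q d} u {v} → Path p d (u ++ v) q →
               ∃ λ r → ∃₂ λ b c → Path p b u r × Path r c v q × (T d → T b ⊎ T c)
  path-split {p} {d = d} [] π = p , false , d , ((λ ()) , refl) , π , inj₂
  path-split {d = d} (a ∷ u) (s , e , st , π , k) with path-split u π
  ... | r , b , c , π₁ , π₂ , h = r , d′ , c , (s , b , st , π₁ , proj₁ ∘ sound) , π₂ , complete
    where
    d′ : Bool
    d′ = isYes (em {(Accepting _ ⊎ T b) × T d})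
    sound : T d′ → (Accepting _ ⊎ T b) × T d
    sound = toWitness {a? = em}
    complete : T d → T d′ ⊎ T c
    complete td = [ (λ acc → inj₁ (fromWitness {a? = em} (inj₁ acc , td)))
                  , Sum.map₁ (λ tb → fromWitness {a? = em} (inj₂ tb , td)) ∘ h ]′ (k td)

  infix 4 _⊑_
  -- One half of Büchi's congruence: the transition profile of `u` is contained in that of `v`.
  _⊑_ : List A → List A → Set
  u ⊑ v = ∀ {p b q} → Path p b u q → Path p b v q

  ⊑-context : ∀ {u v} x y → u ⊑ v → x ++ u ++ y ⊑ x ++ v ++ y
  ⊑-context {u} {v} x y u⊑v π with path-split x π
  ... | _ , _ , _ , π₁ , π₂ , h with path-split u π₂
  ... | _ , _ , _ , π₃ , π₄ , k = path-++ x π₁ (path-++ v (u⊑v π₃) π₄ k) h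

  record Chain : Set where
    field
      state : ℕ → State
      flag  : ℕ → Bool
      word  : ℕ → List⁺ A
      path  : ∀ k → Path (state k) (flag k) (toList (word k)) (state (suc k))
  open Chain

  shift : Chain → Chain
  shift C = record { state = state C ∘ suc ; flag = flag C ∘ suc
                   ; word = word C ∘ suc ; path = path C ∘ suc }

  -- Follows the recursion of `after`, so that at each time the states and the letter between them
  -- come from the same step of a path.
  runAfter : ∀ u {p b} (C : Chain) → Path p b u (state C 0) → ℕ → State
  runAfter _       {p} C _               zero    = p
  runAfter (a ∷ u)     C (_ , _ , _ , π , _) (suc n) = runAfter u C π n
  runAfter []          C _               (suc n) =
    let _ , _ , _ , π , _ = path C 0 in runAfter (tail (word C 0)) (shift C) π n

  runAfter-steps : ∀ u {p b} C (π : Path p b u (state C 0)) n →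
                   Step (runAfter u C π n) (after u (word C) n) (runAfter u C π (suc n))
  runAfter-steps (a ∷ u) C (_ , _ , st , π , _) zero    = st
  runAfter-steps (a ∷ u) C (_ , _ , st , π , _) (suc n) = runAfter-steps u C π n
  runAfter-steps []      C (_ , refl) zero = let _ , _ , st , _ = path C 0 in st
  runAfter-steps []      C _          (suc n) =
    let _ , _ , _ , π , _ = path C 0 in runAfter-steps (tail (word C 0)) (shift C) π n

  runAfter-visits : ∀ u {p b} C (π : Path p b u (state C 0)) → T b →
                    ∃ λ n → Accepting (runAfter u C π n)
  runAfter-visits []      C (¬b , _) tb = contradiction tb ¬b
  runAfter-visits (a ∷ u) C (_ , _ , _ , π , k) tb with k tb
  ... | inj₁ acc = 0 , acc
  ... | inj₂ tc with runAfter-visits u C π tc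
  ...   | n , acc = suc n , acc

  chainRun : Chain → ℕ → State
  chainRun C = runAfter [] {b = false} C ((λ ()) , refl)

  runAfter-++ : ∀ u {p b} C (π : Path p b u (state C 0)) n →
                runAfter u C π (length u + n) ≡ chainRun C n
  runAfter-++ []      C (_ , refl) zero    = refl
  runAfter-++ []      C _          (suc n) = refl
  runAfter-++ (a ∷ u) C (_ , _ , _ , π , _) n = runAfter-++ u C π n

  -- Every word of the chain has at least one letter, so a visit within word `k` cannot occur before
  -- time `k`.
  chainRun-visits : ∀ k C → T (flag C k) → ∃ λ m → k ≤ m × Accepting (chainRun C m)
  chainRun-visits zero C tb =
    let _ , _ , _ , π , h = path C 0 in
    [ (λ acc → 0 , z≤n , acc)
    , (λ tc → let n , acc = runAfter-visits (tail (word C 0)) (shift C) π tc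
              in suc n , z≤n , acc) ]′ (h tb)
  chainRun-visits (suc k) C tb with chainRun-visits k (shift C) tb
  ... | m , k≤m , acc =
    let u = tail (word C 0) ; _ , _ , _ , π , _ = path C 0 in
    suc (length u + m) , s≤s (≤-trans k≤m (m≤n+m m _)) ,
    subst Accepting (sym (runAfter-++ u (shift C) π m)) acc

  module _ {w : Word^ω A} {ws} (w-ws : Factorises w ws 0) (R : AcceptingRun w) where
    open AcceptingRun R

    -- The window is half-open, in line with `Path`: the last state of a path is counted for the
    -- next factor.
    visited : ℕ → List A → Bool
    visited t u = isYes (em {∃ λ m → t ≤ m × m < length u + t × Accepting (run m)})

    path-run : ∀ t u → Reads w t u → Path (run t) (visited t u) u (run (length u + t))
    path-run t [] _ = (λ tb → let m , t≤m , m<t , _ = toWitness {a? = em} tb in <⇒≱ m<t t≤m) , refl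
    path-run t (a ∷ u) (eq , r) =
      run (suc t) , visited (suc t) u , subst (λ x → Step (run t) x (run (suc t))) eq (steps t) ,
      subst (λ s → Path (run (suc t)) (visited (suc t) u) u (run s)) (+-suc (length u) t)
            (path-run (suc t) u r) ,
      first-or-later ∘ toWitness {a? = em}
      where
      first-or-later : (∃ λ m → t ≤ m × m < suc (length u + t) × Accepting (run m)) →
                       Accepting (run t) ⊎ T (visited (suc t) u)
      first-or-later (m , t≤m , m< , acc) with m≤n⇒m<n∨m≡n t≤m
      ... | inj₁ t<m  = inj₂ (fromWitness {a? = em}
                          (m , t<m , subst (m <_) (sym (+-suc (length u) t)) m< , acc))
      ... | inj₂ refl = inj₁ acc

    -- Searches for the factor containing time `m`, with `j` bounding the number of factors still to
    -- be tried.
    locate : ∀ j k m → pos ws 0 k ≤ m → m < pos ws 0 (j + k) → Accepting (run m) →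
             ∃ λ k′ → k ≤ k′ × T (visited (pos ws 0 k′) (toList (ws k′)))
    locate zero    k m ≤m m< acc = contradiction ≤m (<⇒≱ m<)
    locate (suc j) k m ≤m m< acc with m <? pos ws 0 (suc k)
    ... | yes m<′ = k , ≤-refl ,
                    fromWitness {a? = em} (m , ≤m , subst (m <_) (pos-suc ws 0 k) m<′ , acc)
    ... | no  m≮ with locate j (suc k) m (≮⇒≥ m≮)
                             (subst (λ i → m < pos ws 0 i) (sym (+-suc j k)) m<) acc
    ...   | k′ , k<k′ , t = k′ , <⇒≤ k<k′ , t

    runChain : (ws′ : ℕ → List⁺ A) → (∀ k → toList (ws k) ⊑ toList (ws′ k)) → Chain
    runChain ws′ ws⊑ = record
      { state = λ k → run (pos ws 0 k)
      ; flag  = λ k → visited (pos ws 0 k) (toList (ws k))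
      ; word  = ws′
      ; path  = λ k → let t = pos ws 0 k ; u = toList (ws k) in
          ws⊑ k (subst (λ s → Path (run t) (visited t u) u (run s)) (sym (pos-suc ws 0 k))
                       (path-run t u (w-ws k)))
      }

    -- The run on `w` is cut at the factors, and each piece is replaced by a path over the new
    -- factor with the same end states and the same flag. Raised flags recur since the old run
    -- accepts, and each one forces a visit in the new run.
    runChain-accepting : ∀ {w′ ws′} → w′ ≗ concat^ω ws′ →
                         (∀ k → toList (ws k) ⊑ toList (ws′ k)) → AcceptingRun w′
    runChain-accepting {ws′ = ws′} w′≗ ws⊑ = record
      { run    = chainRun C
      ; starts = starts
      ; steps  = λ n → subst (λ x → Step (chainRun C n) x (chainRun C (suc n))) (sym (w′≗ n))
                             (runAfter-steps [] C _ n)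
      ; infinitelyOften = λ k →
          let m , ≤m , acc = infinitelyOften (pos ws 0 k)
              -- Each factor advances the position by at least one, so `suc m` factors reach beyond
              -- time `m`.
              k′ , k≤k′ , t = locate (suc m) k m ≤m
                (≤-trans (pos-increasing ws (suc m)) (pos-mono (m≤m+n (suc m) k))) acc
              m′ , k′≤m′ , acc′ = chainRun-visits k′ C t
          in m′ , ≤-trans k≤k′ k′≤m′ , acc′
      }
      where
      C : Chain
      C = runChain ws′ ws⊑
      pos-mono : ∀ {i j} → i ≤ j → pos ws 0 i ≤ pos ws 0 j
      pos-mono {i} {j} i≤j = subst (λ j → pos ws 0 i ≤ pos ws 0 j) (m∸n+n≡m i≤j) (go (j ∸ i))
        where
        go : ∀ d → pos ws 0 i ≤ pos ws 0 (d + i)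
        go zero    = ≤-refl
        go (suc d) = ≤-trans (go d)
          (subst (pos ws 0 (d + i) ≤_) (sym (pos-suc ws 0 (d + i))) (m≤n+m _ _))

  bit : Set → Fin 2
  bit P with em {P}
  ... | yes _ = suc zero
  ... | no  _ = zero

  bit-injective : ∀ P Q → bit P ≡ bit Q → P → Q
  bit-injective P Q eq p with em {P} | em {Q}
  ... | _      | yes q = q
  ... | no ¬p  | no _  = contradiction p ¬p

  private
    N : ℕ
    N = proj₁ finite
    open Inverse (proj₂ finite) using (to; from; strictlyInverseʳ)

  -- The number of possible profiles: for each pair of states, one bit for paths with flag `true`
  -- and one for flag `false`.
  codeSize : ℕ
  codeSize = ((2 * 2) ^ N) ^ N

  pathCode : List A → State → State → Fin (2 * 2)
  pathCode u p q = combine (bit (Path p true u q)) (bit (Path p false u q))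

  code : List A → Fin codeSize
  code u = funToFin λ i → funToFin λ j → pathCode u (from i) (from j)

  code⇒⊑ : ∀ u v → code u ≡ code v → u ⊑ v
  code⇒⊑ u v eq {p} {b} {q} = case-b b
    where
    entry : ∀ p q → pathCode u p q ≡ pathCode v p q
    entry p q = begin
      pathCode u p q
        ≡⟨ lookup-code u ⟨
      finToFun (finToFun (code u) (to p)) (to q)
        ≡⟨ cong (λ c → finToFun {n = N} (finToFun {n = N} c (to p)) (to q)) eq ⟩
      finToFun (finToFun (code v) (to p)) (to q)
        ≡⟨ lookup-code v ⟩
      pathCode v p q ∎
      where
      open ≡-Reasoning
      lookup-code : ∀ u → finToFun (finToFun (code u) (to p)) (to q) ≡ pathCode u p q
      lookup-code u = begin
        finToFun (finToFun (code u) (to p)) (to q)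
          ≡⟨ cong (λ c → finToFun {n = N} c (to q)) (finToFun-funToFin {N} _ (to p)) ⟩
        finToFun (funToFin {N} (λ j → pathCode u (from (to p)) (from j))) (to q)
          ≡⟨ finToFun-funToFin {N} _ (to q) ⟩
        pathCode u (from (to p)) (from (to q))
          ≡⟨ cong₂ (pathCode u) (strictlyInverseʳ p) (strictlyInverseʳ q) ⟩
        pathCode u p q ∎
    bits : bit (Path p true u q) ≡ bit (Path p true v q) ×
           bit (Path p false u q) ≡ bit (Path p false v q)
    bits = combine-injective _ _ _ _ (entry p q)
    case-b : ∀ b → Path p b u q → Path p b v q
    case-b true  = bit-injective _ _ (proj₁ bits)
    case-b false = bit-injective _ _ (proj₂ bits)

module Saturation (em : ExcludedMiddle 0ℓ) {A : Set} {L : Language^ω A} (ωreg : ωRegular L) where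
  open BüchiPaths em (proj₁ ωreg) public

  saturation : ∀ {w w′ ws ws′} → w ≗ concat^ω ws → w′ ≗ concat^ω ws′ →
               (∀ k → toList (ws k) ⊑ toList (ws′ k)) → L w → L w′
  saturation {w} {w′} w≗ w′≗ ws⊑ w∈L =
    Equivalence.from (proj₂ ωreg w′)
      (runChain-accepting (≗⇒factorises w≗) (Equivalence.to (proj₂ ωreg w) w∈L) w′≗ ws⊑)

-- Finiteness of setoids.

module FiniteSetoids (em : ExcludedMiddle 0ℓ) (S : Setoid 0ℓ 0ℓ) where
  open Setoid S renaming (refl to ≈-refl; sym to ≈-sym; trans to ≈-trans) hiding (reflexive)

  private
    decSetoid : DecSetoid 0ℓ 0ℓ
    decSetoid = record { isDecEquivalence = record { isEquivalence = isEquivalence ; _≟_ = λ _ _ → em } }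

    lookup-injective : ∀ {xs} → AllPairs (λ x y → ¬ x ≈ y) xs →
                       ∀ i j → lookup xs i ≈ lookup xs j → i ≡ j
    lookup-injective (x≉ ∷ _)  zero    zero    _  = refl
    lookup-injective (x≉ ∷ _)  zero    (suc j) eq = contradiction eq (All.lookup x≉ (∈-lookup j))
    lookup-injective (x≉ ∷ _)  (suc i) zero    eq = contradiction (≈-sym eq) (All.lookup x≉ (∈-lookup i))
    lookup-injective (_  ∷ ps) (suc i) (suc j) eq = cong suc (lookup-injective ps i j eq)

  covered⇒finite : ∀ xs → (∀ x → Any (x ≈_) xs) → FiniteSetoid S
  covered⇒finite xs cover = length reps , record
    { to        = index
    ; from      = lookup reps
    ; to-cong   = λ {x} {y} x≈y → distinct _ _ (≈-trans (≈-sym (index-≈ x)) (≈-trans x≈y (index-≈ y)))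
    ; from-cong = λ { refl → ≈-refl }
    ; inverse   = (λ {i} y≈ → distinct _ _ (≈-trans (≈-sym (index-≈ _)) y≈))
                , (λ { {x} refl → ≈-sym (index-≈ x) })
    }
    where
    reps : List Carrier
    reps = deduplicate (DecSetoid._≟_ decSetoid) xs
    distinct : ∀ i j → lookup reps i ≈ lookup reps j → i ≡ j
    distinct = lookup-injective (deduplicate-! decSetoid xs)
    found : ∀ x → Any (x ≈_) reps
    found x = deduplicate⁺ (DecSetoid._≟_ decSetoid) (λ y≈z x≈z → ≈-trans x≈z (≈-sym y≈z)) (cover x)
    index : Carrier → Fin (length reps)
    index x = Any.index (found x)
    index-≈ : ∀ x → x ≈ lookup reps (index x)
    index-≈ x = lookup-index (found x)

  -- Excluded middle selects one element for every code that is attained; these elements cover the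
  -- setoid.
  coded⇒finite : ∀ {K} (f : Carrier → Fin K) → (∀ {x y} → f x ≡ f y → x ≈ y) → FiniteSetoid S
  coded⇒finite {K} f f-inj = covered⇒finite (concatMap fibre (allFin K)) λ x →
    concatMap⁺ fibre (Any.map (λ { refl → in-fibre x }) (∈-allFin (f x)))
    where
    fibre : Fin K → List Carrier
    fibre i with em {∃ λ x → f x ≡ i}
    ... | yes (x , _) = x ∷ []
    ... | no  _       = []
    in-fibre : ∀ x → Any (x ≈_) (fibre (f x))
    in-fibre x with em {∃ λ y → f y ≡ f x}
    ... | yes (y , eq) = here (f-inj (sym eq))
    ... | no  none     = contradiction (x , refl) none

-- The syntactic congruence and the monoid it defines.

module Syntactic (em : ExcludedMiddle 0ℓ) {A : Set} {L : Language^ω A} (ωreg : ωRegular L) where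
  open Classical em
  open Saturation em ωreg

  infix 4 _≼_ _≲_ _≈_

  _≼_ : List⁺ A → List⁺ A → Set
  X ≼ Y = ∀ Z → (L (lasso X Z) → L (lasso Y Z)) × (L (lasso Z X) → L (lasso Z Y))

  -- A one-sided form of Arnold's syntactic congruence. The equations with `X` and `Y` select the
  -- contexts whose products are nonempty, as stems and periods must be.
  _≲_ : List A → List A → Set
  u ≲ v = ∀ x y {X Y} → toList X ≡ x ++ u ++ y → toList Y ≡ x ++ v ++ y → X ≼ Y

  -- The empty word forms a class of its own: otherwise transitivity could
  -- pass through a context whose period is empty.
  _≈_ : List A → List A → Set
  u ≈ v = null u ≡ null v × u ≲ v × v ≲ u

  private
    null-++ : ∀ (u v : List A) → null (u ++ v) ≡ null u ∧ null v
    null-++ []      v = refl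
    null-++ (_ ∷ _) v = refl

    nonempty : ∀ {X : List⁺ A} {u} v → toList X ≡ u → null u ≡ null v →
               ∃ λ (Y : List⁺ A) → toList Y ≡ v
    nonempty (a ∷ v) _    _  = a ∷ v , refl
    nonempty []      refl ()

    null-context : ∀ x {u v : List A} y → null u ≡ null v → null (x ++ u ++ y) ≡ null (x ++ v ++ y)
    null-context x {u} {v} y eq = begin
      null (x ++ u ++ y)         ≡⟨ null-++ x (u ++ y) ⟩
      null x ∧ null (u ++ y)     ≡⟨ cong (null x ∧_) (null-++ u y) ⟩
      null x ∧ (null u ∧ null y) ≡⟨ cong (λ b → null x ∧ (b ∧ null y)) eq ⟩
      null x ∧ (null v ∧ null y) ≡⟨ cong (null x ∧_) (null-++ v y) ⟨
      null x ∧ null (v ++ y)     ≡⟨ null-++ x (v ++ y) ⟨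
      null (x ++ v ++ y)         ∎
      where open ≡-Reasoning

  -- Equal emptiness of `u` and `v` makes the middle product `x ++ v ++ y` nonempty, hence usable as
  -- a stem or period.
  ≲-trans : ∀ {u v w} → null u ≡ null v → u ≲ v → v ≲ w → u ≲ w
  ≲-trans {v = v} nu u≲v v≲w x y X≡ W≡ Z with nonempty (x ++ v ++ y) X≡ (null-context x y nu)
  ... | Y , Y≡ =
    proj₁ (v≲w x y Y≡ W≡ Z) ∘ proj₁ (u≲v x y X≡ Y≡ Z) ,
    proj₂ (v≲w x y Y≡ W≡ Z) ∘ proj₂ (u≲v x y X≡ Y≡ Z)

  ≈-sym : ∀ {u v} → u ≈ v → v ≈ u
  ≈-sym (n , p , q) = sym n , q , p

  ≈-trans : ∀ {u v w} → u ≈ v → v ≈ w → u ≈ w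
  ≈-trans (n , p , q) (n′ , p′ , q′) = trans n n′ , ≲-trans n p p′ , ≲-trans (sym n′) q′ q

  lasso-⊑ : ∀ {X Y X′ Y′} → toList X ⊑ toList X′ → toList Y ⊑ toList Y′ →
            ∀ k → toList ((X ∷ω const Y) k) ⊑ toList ((X′ ∷ω const Y′) k)
  lasso-⊑ X⊑ Y⊑ zero    = X⊑
  lasso-⊑ X⊑ Y⊑ (suc _) = Y⊑

  ⊑⇒≼ : ∀ {X Y} → toList X ⊑ toList Y → X ≼ Y
  ⊑⇒≼ {X} {Y} X⊑Y Z =
    saturation (λ _ → refl) (λ _ → refl) (lasso-⊑ {X} {Z} {Y} {Z} X⊑Y id) ,
    saturation (λ _ → refl) (λ _ → refl) (lasso-⊑ {Z} {X} {Z} {Y} id X⊑Y)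

  ⊑⇒≲ : ∀ {u v} → u ⊑ v → u ≲ v
  ⊑⇒≲ {u} {v} u⊑v x y {X} {Y} X≡ Y≡ = ⊑⇒≼ {X} {Y} λ {p} {b} {q} π →
    subst (λ w → Path p b w q) (sym Y≡)
      (⊑-context {u} {v} x y u⊑v (subst (λ w → Path p b w q) X≡ π))

  classCode : List A → Fin (2 * codeSize)
  classCode u = combine (Inverse.from 2↔Bool (null u)) (code u)

  -- Equal profiles give `⊑` both ways, hence interchangeability by saturation, and the extra bit
  -- settles emptiness. It follows that `≈` has finite index.
  classCode⇒≈ : ∀ {u v} → classCode u ≡ classCode v → u ≈ v
  classCode⇒≈ {u} {v} eq
    with combine-injective (Inverse.from 2↔Bool (null u)) _ (Inverse.from 2↔Bool (null v)) _ eq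
  ... | n , c = from-injective n , ⊑⇒≲ {u} {v} (code⇒⊑ u v c) , ⊑⇒≲ {v} {u} (code⇒⊑ v u (sym c))
    where
    from-injective : ∀ {b c} → Inverse.from 2↔Bool b ≡ Inverse.from 2↔Bool c → b ≡ c
    from-injective {b} {c} eq = trans (sym (Inverse.strictlyInverseˡ 2↔Bool b))
      (trans (cong (Inverse.to 2↔Bool) eq) (Inverse.strictlyInverseˡ 2↔Bool c))

  ≈-refl : ∀ {u} → u ≈ u
  ≈-refl = classCode⇒≈ refl

  ≈-reflexive : ∀ {u v} → u ≡ v → u ≈ v
  ≈-reflexive refl = ≈-refl

  private
    regroup-context : ∀ (x z u t y : List A) → (x ++ z) ++ u ++ (t ++ y) ≡ x ++ (z ++ u ++ t) ++ y
    regroup-context x z u t y = begin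
      (x ++ z) ++ u ++ t ++ y ≡⟨ ++-assoc x z _ ⟩
      x ++ z ++ u ++ t ++ y   ≡⟨ cong (λ v → x ++ z ++ v) (++-assoc u t y) ⟨
      x ++ z ++ (u ++ t) ++ y ≡⟨ cong (x ++_) (++-assoc z (u ++ t) y) ⟨
      x ++ (z ++ u ++ t) ++ y ∎
      where open ≡-Reasoning

  ≈-context : ∀ z t {u v} → u ≈ v → z ++ u ++ t ≈ z ++ v ++ t
  ≈-context z t {u} {v} (n , p , q) = null-context z t n , ≲-context p , ≲-context q
    where
    ≲-context : ∀ {u v} → u ≲ v → z ++ u ++ t ≲ z ++ v ++ t
    ≲-context {u} {v} p x y X≡ Y≡ =
      p (x ++ z) (t ++ y) (trans X≡ (sym (regroup-context x z u t y)))
                          (trans Y≡ (sym (regroup-context x z v t y)))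

  ++-cong : ∀ {u u′ v v′} → u ≈ u′ → v ≈ v′ → u ++ v ≈ u′ ++ v′
  ++-cong {u} {u′} {v} {v′} p q = ≈-trans (≈-context [] v p)
    (subst₂ (λ s t → u′ ++ s ≈ u′ ++ t) (++-identityʳ v) (++-identityʳ v′) (≈-context u′ [] q))

  ≈⇒≼ : ∀ {X Y} → toList X ≈ toList Y → X ≼ Y
  ≈⇒≼ (_ , p , _) = p [] [] (sym (++-identityʳ _)) (sym (++-identityʳ _))

  seg-cong : ∀ {ws ws′ : ℕ → List⁺ A} → (∀ i → toList (ws i) ≈ toList (ws′ i)) →
             ∀ j d → toList (seg ws j d) ≈ toList (seg ws′ j d)
  seg-cong ws≈ j zero    = ws≈ j
  seg-cong ws≈ j (suc d) = ++-cong (seg-cong ws≈ j d) (ws≈ _)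

  -- The definition of `≈` speaks of lassos only. Ramsey's theorem and saturation turn `w` into a
  -- lasso, `≈` exchanges its stem and period for those of the other factorisation, and saturation
  -- leads from there to `w′`.
  recognises→ : ∀ {w w′ ws ws′} → w ≗ concat^ω ws → w′ ≗ concat^ω ws′ →
                (∀ i → toList (ws i) ≈ toList (ws′ i)) → L w → L w′
  recognises→ {w} {w′} {ws} {ws′} w≗ w′≗ ws≈ w∈L = from-lasso (to-lasso w∈L)
    where
    -- Colouring by the codes of both factorisations makes the same cuts serve `w` and `w′`.
    c : ℕ → ℕ → Fin (codeSize * codeSize)
    c i d = combine (code (toList (seg ws i d))) (code (toList (seg ws′ i d)))

    gaps = ramsey-gaps c
    e = proj₁ gaps
    i = proj₁ (proj₂ gaps)
    d = proj₁ (proj₂ (proj₂ gaps))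
    i-suc : ∀ k → i (suc k) ≡ suc (d k + i k)
    i-suc = proj₁ ∘ proj₂ (proj₂ (proj₂ gaps))
    same : ∀ k → c (i k) (d k) ≡ c (i 0) (d 0)
    same k = trans (proj₂ (proj₂ (proj₂ (proj₂ gaps)) k)) (sym (proj₂ (proj₂ (proj₂ (proj₂ gaps)) 0)))
    same-codes : ∀ k → code (toList (seg ws (i k) (d k))) ≡ code (toList (seg ws (i 0) (d 0)))
                     × code (toList (seg ws′ (i k) (d k))) ≡ code (toList (seg ws′ (i 0) (d 0)))
    same-codes k = combine-injective _ _ _ _ (same k)

    -- The first block is extended back to factor 0 and becomes the stem; the later blocks all have
    -- the profile of the segment at `i 0`.
    cut gap : ℕ → ℕ
    cut = 0 ∷ω (i ∘ suc)
    gap = (d 0 + i 0) ∷ω (d ∘ suc)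
    cut-suc : ∀ k → cut (suc k) ≡ suc (gap k + cut k)
    cut-suc zero    = trans (i-suc 0) (cong suc (sym (+-identityʳ _)))
    cut-suc (suc k) = i-suc (suc k)

    block : (ℕ → List⁺ A) → ℕ → List⁺ A
    block us k = seg us (cut k) (gap k)
    blocks : ∀ {u us} → u ≗ concat^ω us → u ≗ concat^ω (block us)
    blocks u≗ = factorises⇒≗ (regroup (≗⇒factorises u≗) cut gap refl cut-suc)

    S E S′ E′ : List⁺ A
    S  = block ws 0
    E  = seg ws (i 0) (d 0)
    S′ = block ws′ 0
    E′ = seg ws′ (i 0) (d 0)

    to-lasso : L w → L (lasso S′ E′)
    -- A lasso allows one replacement at a time: first the stem, then the period.
    to-lasso w∈L = proj₂ (≈⇒≼ {E} {E′} (seg-cong ws≈ (i 0) (d 0)) S′)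
      (proj₁ (≈⇒≼ {S} {S′} (seg-cong ws≈ 0 (gap 0)) E)
        (saturation (blocks w≗) (λ _ → refl) ⊑E w∈L))
      where
      ⊑E : ∀ k → toList (block ws k) ⊑ toList ((S ∷ω const E) k)
      ⊑E zero    = id
      ⊑E (suc k) = code⇒⊑ (toList (block ws (suc k))) (toList E) (proj₁ (same-codes (suc k)))

    from-lasso : L (lasso S′ E′) → L w′
    from-lasso = saturation (λ _ → refl) (blocks w′≗) E⊑
      where
      E⊑ : ∀ k → toList ((S′ ∷ω const E′) k) ⊑ toList (block ws′ k)
      E⊑ zero    = id
      E⊑ (suc k) = code⇒⊑ (toList E′) (toList (block ws′ (suc k))) (sym (proj₂ (same-codes (suc k))))

  private
    singletons : ∀ (w : Word^ω A) → w ≗ concat^ω (λ i → w i ∷ [])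
    singletons w zero    = refl
    singletons w (suc n) = singletons (w ∘ suc) n

  -- `L` is an arbitrary predicate on functions; regularity makes it extensional, by saturation for
  -- the factorisation into single letters.
  respects-≗ : ∀ {w w′} → w ≗ w′ → L w → L w′
  respects-≗ {w} w≗w′ =
    saturation (singletons w) (λ n → trans (sym (w≗w′ n)) (singletons w n)) (λ _ → id)

  monoid : Monoid 0ℓ 0ℓ
  monoid = record
    { Carrier  = List A
    ; _≈_      = _≈_
    ; _∙_      = _++_
    ; ε        = []
    ; isMonoid = record
      { isSemigroup = record
        { isMagma = record
          { isEquivalence = record { refl = ≈-refl ; sym = ≈-sym ; trans = ≈-trans }
          ; ∙-cong        = ++-cong }
        ; assoc = λ x y z → ≈-reflexive (++-assoc x y z) }
      ; identity = (λ _ → ≈-refl) , (λ x → ≈-reflexive (++-identityʳ x)) }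
    }

  monoid-finite : FiniteSetoid (Monoid.setoid monoid)
  monoid-finite = FiniteSetoids.coded⇒finite em (Monoid.setoid monoid) classCode classCode⇒≈

  monoid-recognises : Recognises monoid id L
  monoid-recognises w w′ ws ws′ w≗ w′≗ ws≈ =
    mk⇔ (recognises→ w≗ w′≗ ws≈) (recognises→ w′≗ w≗ (≈-sym ∘ ws≈))

-- Words read along the states of a play.

module _ {A : Set} where

  reads-pointwise : ∀ {w : Word^ω A} {t} u → (∀ (i : Fin (length u)) → w (toℕ i + t) ≡ lookup u i) →
                    Reads w t u
  reads-pointwise []      h = tt
  reads-pointwise {w} {t} (a ∷ u) h = h zero , reads-pointwise u λ i →
    trans (cong w (+-suc (toℕ i) t)) (h (suc i))

module Plays {A : Set} (G : Arena A) where
  open Arena G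
  open Game G

  src-move : ∀ σ h → src (move σ h) ≡ current h
  src-move σ (inj₁ v) = src-start σ v
  src-move σ (inj₂ w) = go w (snocView w)
    where
    go : ∀ w → SnocView w → src (move σ (inj₂ w)) ≡ tgt (last w)
    go _ (xs ∷ʳ′ e) = trans (src-next σ xs e) (cong tgt (sym (last-∷ʳ xs e)))

  extend-last : ∀ h e → ∃ λ w → extend h e ≡ inj₂ w × last w ≡ e
  extend-last (inj₁ _) e = _ , refl , refl
  extend-last (inj₂ w) e = _ , refl , last-∷ʳ (toList w) e

  module _ (σ₁ σ₂ : Strategy) (q : V) where

    history : ℕ → History
    history = historyAt σ₁ σ₂ q

    visit : ℕ → V
    visit n = current (history n)

    src-play : ∀ n → src (play σ₁ σ₂ q n) ≡ visit n
    src-play n = go (visit n)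
      where
      go : ∀ v → src (moveAt σ₁ σ₂ v (history n)) ≡ visit n
      go (inj₁ _) = src-move σ₁ (history n)
      go (inj₂ _) = src-move σ₂ (history n)

    visit-suc : ∀ n → visit (suc n) ≡ tgt (play σ₁ σ₂ q n)
    visit-suc n with extend-last (history n) (play σ₁ σ₂ q n)
    ... | w , eq , l = trans (cong current eq) (cong tgt l)

    -- `moveAt` reduces only when the owner of the current state is exposed, so that state enters
    -- through an equation.
    visit-suc-at : ∀ n {v} → visit n ≡ v → visit (suc n) ≡ tgt (moveAt σ₁ σ₂ v (history n))
    visit-suc-at n refl = visit-suc n

-- The gadget arena and the exchange argument.

module Exchange (em : ExcludedMiddle 0ℓ) {A : Set} {L : Language^ω A} (ωreg : ωRegular L)
                (positional : Positional L) where
  open Syntactic em ωreg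

  -- The plays read X (ρ r · m · σ s)(ρ r′ · m · σ s′) ⋯ if loop is true, and
  -- ρ r · m · σ s · X · X ⋯ if it is false; Player 2 picks r and Player 1 picks s.
  module BlockArena {k} (someIndex : Fin k) (X : List⁺ A) (m : A)
                    (ρ σ : Fin k → List⁺ A) (loop : Bool) where

    data Block : Set where
      context   : Block
      challenge : Fin k → Block
      answer    : Fin k → Block

    word : Block → List⁺ A
    word context       = X
    word (challenge r) = ρ r
    word (answer s)    = σ s

    size : Block → ℕ
    size b = length (toList (word b))

    Position : Set
    Position = Σ Block λ b → Fin (size b)

    State : Set
    State = ⊤ ⊎ Position

    pattern choice = inj₁ tt
    pattern at b i = inj₂ (b , i)

    start : Block → State
    start b = at b zero

    -- With `false` no exit leads to a challenge: the only challenge is the one in which the play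
    -- starts.
    data Exit : Bool → Block → State → Set where
      toChoice      : ∀ {l r} → Exit l (challenge r) choice
      answered      : ∀ {s} r → Exit true (answer s) (start (challenge r))
      fromContext   : ∀ r → Exit true context (start (challenge r))
      intoContext   : ∀ {s} → Exit false (answer s) (start context)
      repeatContext : Exit false context (start context)

    data Next : State → State → Set where
      inside : ∀ {b i j} → toℕ j ≡ suc (toℕ i) → Next (at b i) (at b j)
      exit   : ∀ {b i v} → suc (toℕ i) ≡ size b → Exit loop b v → Next (at b i) v
      reply  : ∀ s → Next choice (start (answer s))

    someExit : ∀ l b → ∃ (Exit l b)
    someExit true  context       = _ , fromContext someIndex
    someExit false context       = _ , repeatContext
    someExit _     (challenge r) = _ , toChoice
    someExit true  (answer s)    = _ , answered someIndex
    someExit false (answer s)    = _ , intoContext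

    someNext : ∀ v → ∃ (Next v)
    someNext choice   = _ , reply someIndex
    someNext (at b i) with m≤n⇒m<n∨m≡n (toℕ<n i)
    ... | inj₁ i+1<n = at b (fromℕ< i+1<n) , inside (toℕ-fromℕ< i+1<n)
    ... | inj₂ i+1≡n = proj₁ (someExit loop b) , exit i+1≡n (proj₂ (someExit loop b))

    positions : List Position
    positions = concatMap (λ b → map (b ,_) (allFin (size b)))
      (context ∷ map challenge (allFin k) ++ map answer (allFin k))

    finite-positions : Finite Position
    finite-positions = FiniteSetoids.covered⇒finite em (setoid Position) positions λ (b , i) →
      ∈-concatMap⁺ (λ b → map (b ,_) (allFin (size b)))
        (Any.map (λ { refl → ∈-map⁺ (b ,_) (∈-allFin i) }) (∈-blocks b))
      where
      ∈-blocks : ∀ b → b ∈ₗ (context ∷ map challenge (allFin k) ++ map answer (allFin k))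
      ∈-blocks context       = here refl
      ∈-blocks (challenge r) = there (∈-++⁺ˡ (∈-map⁺ challenge (∈-allFin r)))
      ∈-blocks (answer s)    = there (∈-++⁺ʳ (map challenge (allFin k)) (∈-map⁺ answer (∈-allFin s)))

    label : State → A
    -- Labels sit on states, so the state in which Player 1 decides contributes a letter of its own
    -- to every round.
    label choice   = m
    label (at b i) = lookup (toList (word b)) i

    arena : Arena A
    arena = record
      -- Player 1 owns `choice` alone, so a positional strategy amounts to one fixed answer to all
      -- challenges.
      { V₁      = ⊤
      ; V₂      = Position
      ; finite₁ = 1 , ↔-sym 1↔⊤
      ; finite₂ = finite-positions
      ; δ       = λ v v′ → isYes (em {Next v v′})
      ; total   = λ v → proj₁ (someNext v) , fromWitness {a? = em} (proj₂ (someNext v))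
      ; π       = label
      }

    open Game arena
    open Plays arena

    edgeTo : ∀ {v v′} → Next v v′ → Edge
    edgeTo {v} {v′} n = edge v v′ (fromWitness {a? = em} n)

    edge-next : ∀ e → Next (src e) (tgt e)
    edge-next e = toWitness {a? = em} (isEdge e)

    someEdge : State → Edge
    someEdge v = edgeTo (proj₂ (someNext v))

    round : Fin k → Fin k → List⁺ A
    round r s = ρ r ⁺++⁺ (m ∷ toList (σ s))

    -- The record of visited states when Player 1 answers challenge r by f r
    -- and Player 2 only issues challenges from Q.
    record Run (f : Fin k → Fin k) (Q : Pred (Fin k) 0ℓ) : Set where
      field
        v          : ℕ → State
        next       : ∀ n → Next (v n) (v (suc n))
        challenged : ∀ n r → v n ≡ start (challenge r) → Q r
        replies    : ∀ n r i → v n ≡ at (challenge r) i → v (suc n) ≡ choice →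
                     v (suc (suc n)) ≡ start (answer (f r))

      private
        next-at : ∀ n {x} → v n ≡ x → Next x (v (suc n))
        next-at n refl = next n

        at-end : ∀ {b i y} → suc (toℕ i) ≡ size b → Next (at b i) y → Exit loop b y
        at-end {b} i+1≡n (inside {j = j} j≡) = contradiction (trans j≡ i+1≡n) (<⇒≢ (toℕ<n j))
        at-end     _     (exit _ e)  = e

        at-inner : ∀ {b i y} j → toℕ j ≡ suc (toℕ i) → Next (at b i) y → y ≡ at b j
        at-inner j j≡ (inside {j = j′} j′≡) = cong (at _) (toℕ-injective (trans j′≡ (sym j≡)))
        at-inner j j≡ (exit i+1≡n _) = contradiction (trans j≡ i+1≡n) (<⇒≢ (toℕ<n j))

      walk : ∀ {t b} → v t ≡ start b → ∀ n i → toℕ i ≡ n → v (n + t) ≡ at b i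
      walk v≡ zero    zero    _   = v≡
      walk {t} {b} v≡ (suc n) (suc i) i≡ = at-inner (suc i) (cong suc (sym (toℕ-inject₁ i)))
        (next-at (n + t) (walk v≡ n (inject₁ i) (trans (toℕ-inject₁ i) (suc-injective i≡))))

      w : Word^ω A
      w = label ∘ v

      read-block : ∀ {t} b → v t ≡ start b →
                   Reads w t (toList (word b)) × Exit loop b (v (size b + t))
      read-block {t} b v≡ =
        reads-pointwise (toList (word b)) (λ i → cong label (walk v≡ (toℕ i) i refl)) ,
        at-end (cong suc (toℕ-fromℕ _)) (next-at _ (walk v≡ _ (fromℕ _) (toℕ-fromℕ _)))

      read-round : ∀ {t} r → v t ≡ start (challenge r) →
                   Reads w t (toList (round r (f r))) ×
                   Exit loop (answer (f r)) (v (length (toList (round r (f r))) + t))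
      read-round {t} r v≡ =
        reads-++ (toList (ρ r)) (proj₁ challenge-read)
          (cong label at-choice , proj₁ answer-read) ,
        subst (λ s → Exit loop (answer (f r)) (v s)) length-round (proj₂ answer-read)
        where
        challenge-read = read-block (challenge r) v≡
        at-choice : v (length (toList (ρ r)) + t) ≡ choice
        at-choice with v (length (toList (ρ r)) + t) | proj₂ challenge-read
        ... | _ | toChoice = refl
        answer-read = read-block (answer (f r))
          (replies (length (tail (ρ r)) + t) r _ (walk v≡ _ (fromℕ _) (toℕ-fromℕ _)) at-choice)
        length-round : size (answer (f r)) + suc (length (toList (ρ r)) + t)
                       ≡ length (toList (round r (f r))) + t
        length-round = begin
          n + suc (l + t)                     ≡⟨ +-suc n (l + t) ⟩
          suc n + (l + t)                     ≡⟨ +-assoc (suc n) l t ⟨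
          suc n + l + t                       ≡⟨ cong (_+ t) (+-comm (suc n) l) ⟩
          l + suc n + t                       ≡⟨ cong (_+ t) (length-++ (toList (ρ r))) ⟨
          length (toList (round r (f r))) + t ∎
          where
          open ≡-Reasoning
          n l : ℕ
          n = size (answer (f r))
          l = size (challenge r)

      module _ {K : List⁺ A} (good : ∀ r → Q r → toList (round r (f r)) ≈ toList K) where

        private
          GoodRound : List⁺ A → Set
          GoodRound u = toList u ≈ toList K


        -- Every round lies in the class of `K`, so the play and the lasso have factorwise
        -- equivalent factorisations and the monoid cannot tell them apart.
        outcome-loop : loop ≡ true → v 0 ≡ start context → L w ⇔ L (lasso X K)
        outcome-loop loop≡ v₀ = monoid-recognises w (lasso X K) (X ∷ω rounds) (X ∷ω const K)
            (factorises⇒≗ factorisation) (λ _ → refl) equivalent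
          where
          AtChallenge : ℕ → Set
          AtChallenge t = ∃ λ r → v t ≡ start (challenge r)

          -- `loop` is a module parameter; matching on the exit needs a variable index `l` tied down
          -- by an equation.
          leave-context : ∀ {l y} → l ≡ true → Exit l context y → ∃ λ r → y ≡ start (challenge r)
          leave-context refl (fromContext r) = r , refl

          leave-answer : ∀ {l s y} → l ≡ true → Exit l (answer s) y → ∃ λ r → y ≡ start (challenge r)
          leave-answer refl (answered r) = r , refl

          nextRound : ∀ {t} → AtChallenge t →
                      ∃ λ u → GoodRound u × Reads w t (toList u) × AtChallenge (length (toList u) + t)
          nextRound {t} (r , v≡) = round r (f r) , good r (challenged t r v≡) ,
            proj₁ (read-round r v≡) , leave-answer loop≡ (proj₂ (read-round r v≡))

          initial : AtChallenge (length (toList X) + 0)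
          initial = leave-context loop≡ (proj₂ (read-block context v₀))

          rounds : ℕ → List⁺ A
          rounds = factors AtChallenge GoodRound nextRound initial

          factorisation : Factorises w (X ∷ω rounds) 0
          factorisation zero    = proj₁ (read-block context v₀)
          factorisation (suc k) = factors-factorise AtChallenge GoodRound nextRound initial k

          equivalent : ∀ i → toList ((X ∷ω rounds) i) ≈ toList ((X ∷ω const K) i)
          equivalent zero    = ≈-refl
          equivalent (suc i) = factors-P AtChallenge GoodRound nextRound initial i

        outcome-stem : ∀ {r} → loop ≡ false → v 0 ≡ start (challenge r) → L w ⇔ L (lasso K X)
        outcome-stem {r} loop≡ v₀ = monoid-recognises w (lasso K X)
            (round r (f r) ∷ω const X) (K ∷ω const X)
            (factorises⇒≗ factorisation) (λ _ → refl) equivalent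
          where
          leave-context : ∀ {l y} → l ≡ false → Exit l context y → y ≡ start context
          leave-context refl repeatContext = refl

          leave-answer : ∀ {l s y} → l ≡ false → Exit l (answer s) y → y ≡ start context
          leave-answer refl intoContext = refl

          repeat : ∀ {t} → v t ≡ start context → Factorises w (const X) t
          repeat v≡ zero    = proj₁ (read-block context v≡)
          repeat v≡ (suc k) = repeat (leave-context loop≡ (proj₂ (read-block context v≡))) k

          factorisation : Factorises w (round r (f r) ∷ω const X) 0
          factorisation zero    = proj₁ (read-round r v₀)
          factorisation (suc k) = repeat (leave-answer loop≡ (proj₂ (read-round r v₀))) k

          equivalent : ∀ i → toList ((round r (f r) ∷ω const X) i) ≈ toList ((K ∷ω const X) i)
          equivalent zero    = good r (challenged 0 r v₀)
          equivalent (suc i) = ≈-refl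

    -- The edge entering choice reveals the challenge, so remembering the last
    -- edge suffices.
    replyTo : (Fin k → Fin k) → State → State → Edge
    replyTo f (at (challenge r) _) choice = edgeTo (reply (f r))
    replyTo f _                    v      = someEdge v

    src-replyTo : ∀ f u v → src (replyTo f u v) ≡ v
    src-replyTo f (at (challenge r) _) choice   = refl
    src-replyTo f (at (challenge r) _) (at _ _) = refl
    src-replyTo f (at context _)       v        = refl
    src-replyTo f (at (answer s) _)    v        = refl
    src-replyTo f choice               v        = refl

    replyStrategy : (Fin k → Fin k) → Strategy
    replyStrategy f = record
      -- The games considered start at a block, never in `choice`, so an arbitrary first move
      -- suffices.
      { move      = λ { (inj₁ v) → someEdge v ; (inj₂ h) → replyTo f (src (last h)) (tgt (last h)) }
      ; src-start = λ v → refl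
      ; src-next  = λ h e → trans (src-replyTo f (src (last (h ∷ʳ e))) _) (cong tgt (last-∷ʳ h e))
      }

    replyRun : ∀ f τ q → Run f (λ _ → ⊤)
    replyRun f τ q = record
      { v          = visit σ₁ τ q
      ; next       = λ n → subst₂ Next (src-play σ₁ τ q n) (sym (visit-suc σ₁ τ q n))
                                  (edge-next (play σ₁ τ q n))
      ; challenged = λ _ _ _ → tt
      ; replies    = λ n r i v≡ v′≡ →
          let h , eq , l = extend-last (history σ₁ τ q n) (play σ₁ τ q n) in
          trans (visit-suc-at σ₁ τ q (suc n) v′≡) (trans (cong (tgt ∘ move σ₁) eq)
          (trans (cong (λ e → tgt (replyTo f (src e) (tgt e))) l)
                 (cong tgt (cong₂ (replyTo f) (trans (src-play σ₁ τ q n) v≡)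
                                              (trans (sym (visit-suc σ₁ τ q n)) v′≡)))))
      }
      where
      σ₁ : Strategy
      σ₁ = replyStrategy f

    insist : Fin k → PositionalStrategy
    insist r₀ = record { choose = λ v → proj₁ (insistAt v) ; src-choose = λ v → proj₂ (insistAt v) }
      where
      insistAt : ∀ v → ∃ λ e → src e ≡ v
      insistAt v with em {Next v (start (challenge r₀))}
      ... | yes n = edgeTo n , refl
      ... | no  _ = someEdge v , refl

    insist-tgt : ∀ r₀ v → Next v (start (challenge r₀)) → tgt (choose (insist r₀) v) ≡ start (challenge r₀)
    insist-tgt r₀ v n with em {Next v (start (challenge r₀))}
    ... | yes _  = refl
    ... | no  ¬n = contradiction n ¬n

    -- Wherever one challenge can be issued, all can, so a Player 2 who insists on `r₀` never enters
    -- another one.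
    next-challenge : ∀ {v r} r₀ → Next v (start (challenge r)) → Next v (start (challenge r₀))
    next-challenge r₀ (exit i≡ (answered _))    = exit i≡ (answered r₀)
    next-challenge r₀ (exit i≡ (fromContext _)) = exit i≡ (fromContext r₀)

    -- The condition on `q` handles a play that starts in a challenge, which no move of Player 2 has
    -- selected.
    insistRun : ∀ τ s₀ r₀ q → tgt (choose τ choice) ≡ start (answer s₀) →
                (∀ r → q ≡ start (challenge r) → r ≡ r₀) → Run (const s₀) (_≡ r₀)
    insistRun τ s₀ r₀ q τ≡ q-challenge = record
      { v          = visit σ₁ σ₂ q
      ; next       = next
      ; challenged = challenged
      ; replies    = λ n r i _ v′≡ →
          trans (visit-suc-at σ₁ σ₂ q (suc n) v′≡) (trans (cong (tgt ∘ choose τ) v′≡) τ≡)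
      }
      where
      σ₁ σ₂ : Strategy
      σ₁ = toStrategy τ
      σ₂ = toStrategy (insist r₀)
      next : ∀ n → Next (visit σ₁ σ₂ q n) (visit σ₁ σ₂ q (suc n))
      next n = subst₂ Next (src-play σ₁ σ₂ q n) (sym (visit-suc σ₁ σ₂ q n)) (edge-next (play σ₁ σ₂ q n))

      challenge-injective : ∀ {r r′} → start (challenge r) ≡ start (challenge r′) → r ≡ r′
      challenge-injective refl = refl

      challenged : ∀ n r → visit σ₁ σ₂ q n ≡ start (challenge r) → r ≡ r₀
      challenged zero    r v≡ = q-challenge r v≡
      challenged (suc n) r v≡ = go (visit σ₁ σ₂ q n) refl
        where
        go : ∀ v → visit σ₁ σ₂ q n ≡ v → r ≡ r₀
        go v vn≡ with subst₂ Next vn≡ v≡ (next n)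
        go choice vn≡ | ()
        go (at b i) vn≡ | nx = challenge-injective (trans (sym v≡)
          (trans (visit-suc-at σ₁ σ₂ q n vn≡)
          (trans (cong (tgt ∘ choose (insist r₀)) vn≡) (insist-tgt r₀ (at b i) (next-challenge r₀ nx)))))

    -- `Start` is the set `W` of positionality. In the stem case the start state carries the
    -- challenge, so a single positional strategy has to win from all of `Start`: the answer is then
    -- fixed before `startFor` picks the start.
    module _ (Start : Pred State 0ℓ) (target : List⁺ A → Word^ω A)
             (startFor : ∀ r₀ → ∃ λ q → Start q × (∀ r → q ≡ start (challenge r) → r ≡ r₀))
             (outcome : ∀ {f Q K} (R : Run f Q) → Start (Run.v R 0) →
                        (∀ r → Q r → toList (round r (f r)) ≈ toList K) → L (Run.w R) ⇔ L (target K))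
             where

        -- `meet` lets Player 1 bring every round into the class of `G`, which wins. The positional
        -- strategy won in return always answers `s₀`, and the challenge `r₀` that `spoil` gives for
        -- it brings every round into the class of `B`.
        positional-exchange : ∀ {G B} → (∀ r → ∃ λ s → toList (round r s) ≈ toList G) →
                              (∀ s → ∃ λ r → toList (round r s) ≈ toList B) → L (target G) → L (target B)
        positional-exchange {G} {B} meet spoil G∈L = B∈L
          where
          f : Fin k → Fin k
          f r = proj₁ (meet r)

          winning : ∀ q → Start q → WinningFrom L (replyStrategy f) q
          winning q q∈ σ₂ = respects-≗ (λ n → cong label (sym (src-play (replyStrategy f) σ₂ q n)))
            (Equivalence.from (outcome {K = G} (replyRun f σ₂ q) q∈ (λ r _ → proj₂ (meet r))) G∈L)

          τ : PositionalStrategy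
          τ = proj₁ (positional arena Start (replyStrategy f) winning)

          answer-of : ∀ {v} → Next choice v → ∃ λ s → v ≡ start (answer s)
          answer-of (reply s) = s , refl

          chosen : ∃ λ s → tgt (choose τ choice) ≡ start (answer s)
          chosen = answer-of (subst (λ v → Next v (tgt (choose τ choice))) (src-choose τ choice)
                                    (edge-next (choose τ choice)))

          s₀ r₀ : Fin k
          s₀ = proj₁ chosen
          r₀ = proj₁ (spoil s₀)

          q : State
          q = proj₁ (startFor r₀)

          B∈L : L (target B)
          B∈L = Equivalence.to
            (outcome {K = B} (insistRun τ s₀ r₀ q (proj₂ chosen) (proj₂ (proj₂ (startFor r₀))))
              (proj₁ (proj₂ (startFor r₀))) (λ { _ refl → proj₂ (spoil s₀) }))
            (respects-≗ (λ n → cong label (src-play (toStrategy τ) (toStrategy (insist r₀)) q n))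
              (proj₂ (positional arena Start (replyStrategy f) winning) q (proj₁ (proj₂ (startFor r₀)))
                     (toStrategy (insist r₀))))

  exchange : ∀ {k} (someIndex : Fin k) X m (ρ σ : Fin k → List⁺ A) {G B} →
             (∀ r → ∃ λ s → toList (ρ r) ++ m ∷ toList (σ s) ≈ toList G) →
             (∀ s → ∃ λ r → toList (ρ r) ++ m ∷ toList (σ s) ≈ toList B) →
             (L (lasso G X) → L (lasso B X)) × (L (lasso X G) → L (lasso X B))
  exchange someIndex X m ρ σ {G} {B} meet spoil =
    Stem.positional-exchange (λ q → ∃ λ r → q ≡ Stem.start (Stem.challenge r)) (λ K → lasso K X)
      (λ r₀ → _ , (r₀ , refl) , λ { _ refl → refl })
      (λ { R (r , v₀) good → Stem.Run.outcome-stem R good refl v₀ }) {G} {B} meet spoil ,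
    Loop.positional-exchange (_≡ Loop.start Loop.context) (lasso X)
      (λ r₀ → _ , refl , λ _ ())
      (λ R v₀ good → Loop.Run.outcome-loop R good refl v₀) {G} {B} meet spoil
    where
    module Stem = BlockArena someIndex X m ρ σ false
    module Loop = BlockArena someIndex X m ρ σ true

-- Exponents modulo the period, and aperiodicity.

-- As `d` grows by one the residue drops by one; at zero it wraps around to `q` and the quotient
-- grows.
complement-mod : ∀ q d → ∃₂ λ (r : Fin (suc q)) c → d + toℕ r ≡ c * suc q
complement-mod q zero    = zero , 0 , refl
complement-mod q (suc d) with complement-mod q d
... | zero  , c , eq = fromℕ q , suc c , (begin
  suc d + toℕ (fromℕ q) ≡⟨ cong (suc d +_) (toℕ-fromℕ q) ⟩
  suc d + q             ≡⟨ cong (λ d → suc d + q) (trans (sym (+-identityʳ d)) eq) ⟩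
  suc (c * suc q) + q   ≡⟨ cong suc (+-comm _ q) ⟩
  suc c * suc q         ∎)
  where open ≡-Reasoning
... | suc r , c , eq = inject₁ r , c , (begin
  suc d + toℕ (inject₁ r) ≡⟨ cong (suc d +_) (toℕ-inject₁ r) ⟩
  suc d + toℕ r           ≡⟨ sym (+-suc d (toℕ r)) ⟩
  d + suc (toℕ r)         ≡⟨ eq ⟩
  c * suc q               ∎)
  where open ≡-Reasoning

toList-++⁺ : {A : Set} (xs : List A) (ys : List⁺ A) → toList (xs ++⁺ ys) ≡ xs ++ toList ys
toList-++⁺ []       ys = refl
toList-++⁺ (x ∷ xs) ys = cong (x ∷_) (toList-++⁺ xs ys)

module Counting (em : ExcludedMiddle 0ℓ) {A : Set} {L : Language^ω A} (ωreg : ωRegular L)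
                (positional : Positional L) where
  open Syntactic em ωreg
  open Exchange em ωreg positional

  infixr 8 _·_
  _·_ : ℕ → List A → List A
  _·_ = RawMonoidDefinitions._×_ (Monoid.rawMonoid monoid)

  ·-+ : ∀ m n u → (m + n) · u ≡ m · u ++ n · u
  ·-+ zero    n u = refl
  ·-+ (suc m) n u = trans (cong (u ++_) (·-+ m n u)) (sym (++-assoc u (m · u) (n · u)))

  module _ (u : List A) {n₀ q : ℕ} (period : n₀ · u ≈ (suc q + n₀) · u) where

    private
      p : ℕ
      p = suc q

    shift-period : ∀ {n} → n₀ ≤ n → n · u ≈ (p + n) · u
    shift-period {n} n₀≤n = subst₂ _≈_
      (trans (sym (·-+ d n₀ u)) (cong (_· u) (m∸n+n≡m n₀≤n)))
      (trans (sym (·-+ d (p + n₀) u)) (cong (_· u) reorder))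
      (++-cong (≈-refl {d · u}) period)
      where
      d : ℕ
      d = n ∸ n₀
      swap : ∀ d p n → d + (p + n) ≡ p + (d + n)
      swap = solve-∀
      reorder : d + (p + n₀) ≡ p + n
      reorder = trans (swap d p n₀) (cong (p +_) (m∸n+n≡m n₀≤n))

    shift-periods : ∀ c {n} → n₀ ≤ n → n · u ≈ (c * p + n) · u
    shift-periods zero    n₀≤n = ≈-refl
    shift-periods (suc c) {n} n₀≤n = ≈-trans (shift-periods c n₀≤n)
      (≈-trans (shift-period (≤-trans n₀≤n (m≤n+m n (c * p))))
               (≈-reflexive (cong (_· u) (sym (+-assoc p (c * p) n)))))

    -- From `n₀` on only the exponent modulo `p` matters, and `e + toℕ r` runs through all residues.
    reach : ∀ {e b} → n₀ ≤ e → n₀ ≤ b → ∃ λ (r : Fin p) → (e + toℕ r) · u ≈ b · u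
    -- `b * q` acts as minus `b` modulo `p`, because `b * q + b` is `b * p`; subtraction is avoided.
    reach {e} {b} n₀≤e n₀≤b with complement-mod q (e + b * q)
    ... | r , c , eq = r , ≈-trans (shift-periods b (≤-trans n₀≤e (m≤m+n e (toℕ r))))
      (≈-trans (≈-reflexive (cong (_· u) (trans (reorder b q e (toℕ r)) (cong (_+ b) eq))))
               (≈-sym (shift-periods c n₀≤b)))
      where
      reorder : ∀ b q e r → b * suc q + (e + r) ≡ e + b * q + r + b
      reorder = solve-∀

  module _ (a : A) (u′ : List A) (n₁ q : ℕ) where

    private
      u : List A
      u = a ∷ u′
      n₀ p : ℕ
      n₀ = suc n₁
      p  = suc q

    -- A round spells `x`, then `u` to the power `(n₀ + r) + (2 + s)`, then `y`. With either index
    -- fixed, the other still reaches every residue modulo `p`: Player 1 can aim at `g` and Player 2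
    -- at `b`.
    powers-≲ : n₀ · u ≈ (p + n₀) · u → ∀ {g b} → n₀ ≤ g → n₀ ≤ b → g · u ≲ b · u
    powers-≲ period {g} {b} n₀≤g n₀≤b x y {G} {B} G≡ B≡ Z = exchange zero Z a ρ σ {G} {B}
      (λ r → let s , eq = reach u period (m≤n⇒m≤n+o 2 (m≤m+n n₀ (toℕ r))) n₀≤g in
        s , towards {G} {g} G≡ r s (≈-trans (≈-reflexive (cong (_· u) (order₁ n₀ (toℕ r) (toℕ s)))) eq))
      (λ s → let r , eq = reach u period (m≤m+n n₀ (2 + toℕ s)) n₀≤b in
        r , towards {B} {b} B≡ r s (≈-trans (≈-reflexive (cong (_· u) (order₂ n₀ (toℕ r) (toℕ s)))) eq))
      where
      -- The letter `a` of `choice` opens a copy of `u` that `σ s` completes; the second copy keeps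
      -- `σ s` nonempty even if `u′` and `y` are empty and `s` is zero.
      ρ σ : Fin p → List⁺ A
      ρ r = x ++⁺ (a ∷ (u′ ++ (n₁ + toℕ r) · u))
      σ s = u′ ++⁺ (a ∷ (u′ ++ toℕ s · u ++ y))

      order₁ : ∀ n r s → (n + r) + (2 + s) ≡ n + r + 2 + s
      order₁ = solve-∀
      order₂ : ∀ n r s → (n + r) + (2 + s) ≡ n + (2 + s) + r
      order₂ = solve-∀

      round≡ : ∀ r s → toList (ρ r) ++ a ∷ toList (σ s)
                       ≡ x ++ ((n₀ + toℕ r) + (2 + toℕ s)) · u ++ y
      round≡ r s = begin
        toList (ρ r) ++ a ∷ toList (σ s)
          ≡⟨ cong₂ (λ v w → v ++ a ∷ w) (toList-++⁺ x _) (toList-++⁺ u′ _) ⟩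
        (x ++ P) ++ (u ++ u ++ toℕ s · u ++ y)
          ≡⟨ cong (λ w → (x ++ P) ++ (u ++ w)) (++-assoc u (toℕ s · u) y) ⟨
        (x ++ P) ++ (u ++ (u ++ toℕ s · u) ++ y)
          ≡⟨ cong ((x ++ P) ++_) (++-assoc u (u ++ toℕ s · u) y) ⟨
        (x ++ P) ++ (Q ++ y)
          ≡⟨ ++-assoc x P (Q ++ y) ⟩
        x ++ P ++ Q ++ y
          ≡⟨ cong (x ++_) (++-assoc P Q y) ⟨
        x ++ (P ++ Q) ++ y
          ≡⟨ cong (λ w → x ++ w ++ y) (·-+ (n₀ + toℕ r) (2 + toℕ s) u) ⟨
        x ++ ((n₀ + toℕ r) + (2 + toℕ s)) · u ++ y ∎
        where
        open ≡-Reasoning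
        P Q : List A
        P = (n₀ + toℕ r) · u
        Q = (2 + toℕ s) · u

      towards : ∀ {K : List⁺ A} {k} → toList K ≡ x ++ k · u ++ y → ∀ r s →
                ((n₀ + toℕ r) + (2 + toℕ s)) · u ≈ k · u →
                toList (ρ r) ++ a ∷ toList (σ s) ≈ toList K
      towards K≡ r s eq = subst₂ _≈_ (sym (round≡ r s)) (sym K≡) (≈-context x y eq)

  aperiodic : Aperiodic monoid
  aperiodic []       = 0 , ≈-refl
  -- Exponents start at one because `powers-≲` needs a positive `n₀`; this also makes both powers
  -- nonempty, so their emptiness agrees by `refl`.
  aperiodic (a ∷ u′) with pigeonhole (n<1+n _) (λ i → classCode (suc (toℕ i) · (a ∷ u′)))
  ... | i , j , i<j , eq = n₀ , refl , powers-≲ a u′ (toℕ i) q period ≤-refl (n≤1+n _)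
                                    , powers-≲ a u′ (toℕ i) q period (n≤1+n _) ≤-refl
    where
    u = a ∷ u′
    n₀ = suc (toℕ i)
    q = toℕ j ∸ n₀
    period : n₀ · u ≈ (suc q + n₀) · u
    period = ≈-trans (classCode⇒≈ {n₀ · u} {suc (toℕ j) · u} eq)
      (≈-reflexive (cong (λ n → suc n · u) (sym (m∸n+n≡m i<j))))

theorem26 : ExcludedMiddle 0ℓ →
    (A : Set) → Finite A → (L : Language^ω A) →
    ωRegular L → Positional L → ωStarFree L
theorem26 em A _ L ωreg positional = record
  { monoid         = monoid
  ; finite         = monoid-finite
  ; aperiodic      = aperiodic
  ; h              = id
  ; isHomomorphism = record
    { isMagmaHomomorphism = record
      { isRelHomomorphism = record { cong = ≈-reflexive }
      ; homo              = λ _ _ → ≈-refl }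
    ; ε-homo              = ≈-refl }
  ; recognises     = monoid-recognises
  }
  where
  open Syntactic em ωreg
  open Counting em ωreg positional
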